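{- Let $G_1$ be a broken sun graph of order $n_1$ with no perfect matching and let $G_2$ be a unicyclic graph of order $n_2$ with a perfect matching. If $L(G_1)$ and $L(G_2)$ both have eigenvalue $2$, then, for any one-edge connection $G_1\odot G_2$, the Laplacian matrix $L(G_1\odot G_2)$ has eigenvalue $2$.
   Context: All graphs are finite, undirected, with no loops or multiple edges. The Laplacian matrix of $G$ is $L(G)=D(G)-A(G)$, where $D(G)$ is the diagonal matrix of vertex degrees and $A(G)$ is the adjacency matrix. A unicyclic graph is a connected graph whose number of edges equals its number of vertices. The sun graph of order $2m$ ($m\ge 3$) is the cycle $C_m$ with one pendant vertex attached to each vertex of the cycle. A broken sun graph is a unicyclic subgraph of a sun graph. A one-edge connection $G_1\odot G_2$ of two (vertex-disjoint) graphs $G_1,G_2$ is any graph $G$ with $V(G)=V(G_1)\cup V(G_2)$ and $E(G)=E(G_1)\cup E(G_2)\cup\{uv\}$ for some $u\in V(G_1)$ and $v\in V(G_2)$. -}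

module Defs where

open import Data.Empty using (⊥)
open import Data.Fin using (Fin; toℕ; splitAt; _<_)
open import Data.Fin.Properties using (_≟_; _<?_)
open import Data.Integer using (+_)
open import Data.List using (List; length; filter; cartesianProduct; allFin)
open import Data.Nat using (ℕ; suc; _+_; _≤_; s≤s)
open import Data.Nat.Properties as ℕ using (1+n≢n)
open import Data.Product using (Σ; ∃!; _×_; _,_)
open import Data.Rational using (ℚ; 0ℚ; 1ℚ; _-_; _*_; _/_)
open import Data.Rational.Properties using (+-0-commutativeMonoid)
open import Data.Sum using (_⊎_; inj₁; inj₂; swap)
open import Data.Bool using (if_then_else_)
open import Function using (Injective; _∘_)
open import Level using (0ℓ)
open import Relation.Binary using (Rel; Decidable; Symmetric)
open import Relation.Binary.Construct.Closure.ReflexiveTransitive using (Star)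
open import Relation.Binary.PropositionalEquality using (_≡_; refl; sym)
open import Relation.Nullary using (¬_; does; no)
open import Relation.Nullary.Decidable using (_×-dec_; _⊎-dec_)
open import Algebra.Properties.CommutativeMonoid.Sum +-0-commutativeMonoid using (sum)

record Graph (V : Set) : Set₁ where
  field
    Adj    : Rel V 0ℓ
    adj?   : Decidable Adj
    symm   : Symmetric Adj
    irrefl : ∀ v → ¬ Adj v v

open Graph public

comap : ∀ {V W} → (V → W) → Graph W → Graph V
comap f G .Adj x y  = Adj G (f x) (f y)
comap f G .adj? x y = adj? G (f x) (f y)
comap f G .symm     = symm G
comap f G .irrefl   = irrefl G ∘ f

-- "G is a subgraph of H" up to the naming of vertices; the subgraph need not
-- be induced or spanning.
_IsSubgraphOf_ : ∀ {V W} → Graph V → Graph W → Set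
_IsSubgraphOf_ {V} {W} G H =
  Σ (V → W) λ f → Injective _≡_ _≡_ f × (∀ {x y} → Adj G x y → Adj H (f x) (f y))

edges : ∀ {n} → Graph (Fin n) → List (Fin n × Fin n)
edges {n} G =
  filter (λ (i , j) → (i <? j) ×-dec adj? G i j) (cartesianProduct (allFin n) (allFin n))

degree : ∀ {n} → Graph (Fin n) → Fin n → ℕ
degree {n} G i = length (filter (adj? G i) (allFin n))

-- The empty graph does not count as connected.
Connected : ∀ {V} → Graph V → Set
Connected {V} G = V × (∀ x y → Star (Adj G) x y)

Unicyclic : ∀ {n} → Graph (Fin n) → Set
Unicyclic {n} G = Connected G × length (edges G) ≡ n

-- The set of matching edges is given as a graph M on the same vertices.
HasPerfectMatching : ∀ {V} → Graph V → Set₁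
HasPerfectMatching {V} G =
  Σ (Graph V) λ M → (∀ {x y} → Adj M x y → Adj G x y) × (∀ x → ∃! _≡_ (Adj M x))

-- Next i j: j = i + 1 modulo m.
Next : ∀ {m} → Rel (Fin m) 0ℓ
Next {m} i j = toℕ j ≡ suc (toℕ i) ⊎ (suc (toℕ i) ≡ m × toℕ j ≡ 0)

next? : ∀ {m} → Decidable (Next {m})
next? {m} i j = (toℕ j ℕ.≟ suc (toℕ i)) ⊎-dec ((suc (toℕ i) ℕ.≟ m) ×-dec (toℕ j ℕ.≟ 0))

next-irrefl : ∀ {m} → 3 ≤ m → (i : Fin m) → ¬ Next i i
next-irrefl _             i (inj₁ e)       = 1+n≢n (sym e)
next-irrefl (s≤s (s≤s _)) i (inj₂ (e , z)) with toℕ i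
next-irrefl (s≤s (s≤s _)) i (inj₂ (() , refl)) | .0

cycle : ∀ m → 3 ≤ m → Graph (Fin m)
cycle m _   .Adj i j          = Next i j ⊎ Next j i
cycle m _   .adj? i j         = next? i j ⊎-dec next? j i
cycle m _   .symm             = swap
cycle m 3≤m .irrefl i (inj₁ p) = next-irrefl 3≤m i p
cycle m 3≤m .irrefl i (inj₂ p) = next-irrefl 3≤m i p

-- inj₁ i is the i-th cycle vertex and inj₂ i the pendant vertex attached to it.
sun : ∀ m → 3 ≤ m → Graph (Fin m ⊎ Fin m)
sun m 3≤m .Adj (inj₁ i) (inj₁ j) = Adj (cycle m 3≤m) i j
sun m 3≤m .Adj (inj₁ i) (inj₂ j) = i ≡ j
sun m 3≤m .Adj (inj₂ i) (inj₁ j) = j ≡ i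
sun m 3≤m .Adj (inj₂ i) (inj₂ j) = ⊥
sun m 3≤m .adj? (inj₁ i) (inj₁ j) = adj? (cycle m 3≤m) i j
sun m 3≤m .adj? (inj₁ i) (inj₂ j) = i ≟ j
sun m 3≤m .adj? (inj₂ i) (inj₁ j) = j ≟ i
sun m 3≤m .adj? (inj₂ i) (inj₂ j) = no λ ()
sun m 3≤m .symm {inj₁ i} {inj₁ j} = symm (cycle m 3≤m)
sun m 3≤m .symm {inj₁ i} {inj₂ j} p = p
sun m 3≤m .symm {inj₂ i} {inj₁ j} p = p
sun m 3≤m .irrefl (inj₁ i) = irrefl (cycle m 3≤m) i
sun m 3≤m .irrefl (inj₂ i) ()

BrokenSun : ∀ {n} → Graph (Fin n) → Set
BrokenSun G = Unicyclic G × Σ ℕ λ m → Σ (3 ≤ m) λ 3≤m → G IsSubgraphOf sun m 3≤m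

joinAt : ∀ {V W} → Graph V → Graph W → V → W →
         Decidable {A = V} _≡_ → Decidable {A = W} _≡_ → Graph (V ⊎ W)
joinAt G H u v _ _ .Adj (inj₁ x) (inj₁ y) = Adj G x y
joinAt G H u v _ _ .Adj (inj₁ x) (inj₂ y) = x ≡ u × y ≡ v
joinAt G H u v _ _ .Adj (inj₂ x) (inj₁ y) = y ≡ u × x ≡ v
joinAt G H u v _ _ .Adj (inj₂ x) (inj₂ y) = Adj H x y
joinAt G H u v _≟₁_ _≟₂_ .adj? (inj₁ x) (inj₁ y) = adj? G x y
joinAt G H u v _≟₁_ _≟₂_ .adj? (inj₁ x) (inj₂ y) = (x ≟₁ u) ×-dec (y ≟₂ v)
joinAt G H u v _≟₁_ _≟₂_ .adj? (inj₂ x) (inj₁ y) = (y ≟₁ u) ×-dec (x ≟₂ v)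
joinAt G H u v _≟₁_ _≟₂_ .adj? (inj₂ x) (inj₂ y) = adj? H x y
joinAt G H u v _ _ .symm {inj₁ x} {inj₁ y} = symm G
joinAt G H u v _ _ .symm {inj₁ x} {inj₂ y} p = p
joinAt G H u v _ _ .symm {inj₂ x} {inj₁ y} p = p
joinAt G H u v _ _ .symm {inj₂ x} {inj₂ y} = symm H
joinAt G H u v _ _ .irrefl (inj₁ x) = irrefl G x
joinAt G H u v _ _ .irrefl (inj₂ x) = irrefl H x

-- G₁ ⊙ G₂ with connecting edge uv; the first n₁ vertices are those of G₁ and
-- the remaining n₂ those of G₂.
oneEdgeConnection : ∀ {n₁ n₂} → Graph (Fin n₁) → Graph (Fin n₂) →
                    Fin n₁ → Fin n₂ → Graph (Fin (n₁ + n₂))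
oneEdgeConnection {n₁} G₁ G₂ u v = comap (splitAt n₁) (joinAt G₁ G₂ u v _≟_ _≟_)

Matrix : ℕ → Set
Matrix n = Fin n → Fin n → ℚ

degreeMatrix adjacencyMatrix laplacian : ∀ {n} → Graph (Fin n) → Matrix n
degreeMatrix    G i j = if does (i ≟ j) then + degree G i / 1 else 0ℚ
adjacencyMatrix G i j = if does (adj? G i j) then 1ℚ else 0ℚ
laplacian       G i j = degreeMatrix G i j - adjacencyMatrix G i j

-- Eigenvalues over the field ℚ.  A rational number is an eigenvalue of a
-- rational matrix over ℚ exactly when it is one over ℝ, since whether the
-- kernel of A - μI is nonzero does not change under field extension.
HasEigenvalue : ∀ {n} → Matrix n → ℚ → Set
HasEigenvalue {n} A μ =
  Σ (Fin n → ℚ) λ x → ¬ (∀ i → x i ≡ 0ℚ) × (∀ i → sum (λ j → A i j * x j) ≡ μ * x i)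

{-# OPTIONS --safe #-}
-- The Laplacian acts by (L x) i = Σ_j A i j (x i - x j).  Hence the connecting
-- edge uv contributes nothing to L (x , y) as soon as x u ≡ y v, and (x , y) is
-- then an eigenvector whenever x and y are.  Arrange x u ≡ y v by taking
-- (x , 0) if x u ≡ 0, and (y v · x , x u · y) otherwise.
module Submission where

open import Defs
open import Algebra.Bundles using (CommutativeRing)
open import Data.Bool using (true; false; if_then_else_)
open import Data.Fin using (Fin; zero; suc; splitAt; _↑ˡ_; _↑ʳ_)
open import Data.Fin.Properties using (_≟_; splitAt-↑ˡ; splitAt-↑ʳ)
open import Data.Integer as ℤ using (+_)
import Data.Integer.Properties as ℤ
open import Data.List using (length; filter; tabulate)
open import Data.Nat using (zero; suc)
open import Data.Product using (_,_)
open import Data.Rational using (ℚ; 0ℚ; 1ℚ; _+_; _-_; _*_; _/_; 1/_; -_; toℚᵘ; ≢-nonZero)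
open import Data.Rational.Properties as ℚ
  using ( +-identityˡ; +-identityʳ; +-inverseʳ; +-assoc; *-comm; *-assoc; *-zeroˡ; *-zeroʳ
        ; *-identityˡ; *-distribˡ-+; +-*-commutativeRing; toℚᵘ-injective; toℚᵘ-fromℚᵘ; toℚᵘ-homo-+)
open import Data.Rational.Solver using (module +-*-Solver)
open import Data.Rational.Unnormalised as ℚᵘ using (mkℚᵘ; *≡*)
import Data.Rational.Unnormalised.Properties as ℚᵘ
open import Data.Sum using (_⊎_; inj₁; inj₂; [_,_]; map)
open import Function using (id; _∘_)
open import Level using (0ℓ)
open import Relation.Binary.PropositionalEquality hiding ([_])
open import Relation.Nullary using (¬_; does; yes; no)
open import Relation.Unary using (Pred; Decidable)
open import Algebra.Properties.Semiring.Sum (CommutativeRing.semiring +-*-commutativeRing)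
  using (sum; sum-cong-≗; sum-replicate-zero; ∑-distrib-+; *-distribˡ-sum; *-distribʳ-sum)

open ≡-Reasoning

-- `_/_` normalises by a gcd, which is stuck on a variable `n`. Among unnormalised rationals the
-- identity is a bare cross-multiplication, and `toℚᵘ-injective` brings it back.
suc-/1 : ∀ n → + suc n / 1 ≡ 1ℚ + + n / 1
suc-/1 n = toℚᵘ-injective (begin′
  toℚᵘ (+ suc n / 1)               ≈⟨ toℚᵘ-fromℚᵘ (mkℚᵘ (+ suc n) 0) ⟩
  mkℚᵘ (+ suc n) 0                 ≈⟨ *≡* (cong (λ k → (+ 1 ℤ.+ k) ℤ.* + 1) (sym (ℤ.*-identityʳ (+ n)))) ⟩
  ℚᵘ.1ℚᵘ ℚᵘ.+ mkℚᵘ (+ n) 0         ≈⟨ ℚᵘ.+-congʳ ℚᵘ.1ℚᵘ (toℚᵘ-fromℚᵘ (mkℚᵘ (+ n) 0)) ⟨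
  ℚᵘ.1ℚᵘ ℚᵘ.+ toℚᵘ (+ n / 1)       ≈⟨ toℚᵘ-homo-+ 1ℚ (+ n / 1) ⟨
  toℚᵘ (1ℚ + + n / 1)              ∎′)
  where open import Relation.Binary.Reasoning.Setoid ℚᵘ.≃-setoid renaming (begin_ to begin′_; _∎ to _∎′)

-- With `f = id` this makes each degree a row sum of the adjacency matrix. A general `f` lets the
-- induction pass to `f ∘ suc`.
length-filter-tabulate : ∀ {A : Set} {P : Pred A 0ℓ} (P? : Decidable P) {n} (f : Fin n → A) →
  + length (filter P? (tabulate f)) / 1 ≡ sum (λ j → if does (P? (f j)) then 1ℚ else 0ℚ)
length-filter-tabulate P? {zero}  f = refl
length-filter-tabulate P? {suc n} f with does (P? (f zero))
... | true  = trans (suc-/1 (length (filter P? (tabulate (f ∘ suc)))))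
                    (cong (_+_ 1ℚ) (length-filter-tabulate P? (f ∘ suc)))
... | false = trans (length-filter-tabulate P? (f ∘ suc)) (sym (+-identityˡ _))

sum-zero : ∀ {n} {f : Fin n → ℚ} → (∀ i → f i ≡ 0ℚ) → sum f ≡ 0ℚ
sum-zero {n} f≡0 = trans (sum-cong-≗ f≡0) (sum-replicate-zero n)

sum-diagonal : ∀ {n} c (i : Fin n) (x : Fin n → ℚ) →
  sum (λ j → (if does (i ≟ j) then c else 0ℚ) * x j) ≡ c * x i
sum-diagonal c zero    x =
  trans (cong (_+_ (c * x zero)) (sum-zero λ j → *-zeroˡ (x (suc j)))) (+-identityʳ _)
-- `does (suc i ≟ suc j)` computes to `does (i ≟ j)`, so the tail is the same sum for `i`.
sum-diagonal c (suc i) x =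
  trans (cong₂ _+_ (*-zeroˡ (x zero)) (sum-diagonal c i (x ∘ suc))) (+-identityˡ _)

sum-splitAt : ∀ m {n} (f : Fin m ⊎ Fin n → ℚ) →
  sum (f ∘ splitAt m) ≡ sum (f ∘ inj₁) + sum (f ∘ inj₂)
sum-splitAt zero    f = sym (+-identityˡ _)
sum-splitAt (suc m) f =
  -- `splitAt (suc m) (suc i)` unfolds to `map suc id (splitAt m i)`, whence this argument of the
  -- induction hypothesis.
  trans (cong (_+_ (f (inj₁ zero))) (sum-splitAt m (f ∘ map suc id)))
        (sym (+-assoc (f (inj₁ zero)) (sum (f ∘ inj₁ ∘ suc)) (sum (f ∘ inj₂))))

laplacian-apply : ∀ {n} (G : Graph (Fin n)) x i →
  sum (λ j → laplacian G i j * x j) ≡ sum (λ j → adjacencyMatrix G i j * (x i - x j))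
laplacian-apply {n} G x i = begin
  sum (λ j → (D j - A j) * x j)
    ≡⟨ sum-cong-≗ (λ j → distrib (D j) (A j) (x j)) ⟩
  sum (λ j → D j * x j + A j * - x j)
    ≡⟨ ∑-distrib-+ (λ j → D j * x j) _ ⟩
  sum (λ j → D j * x j) + sum (λ j → A j * - x j)
    ≡⟨ cong (_+ rest) (sum-diagonal (+ degree G i / 1) i x) ⟩
  + degree G i / 1 * x i + sum (λ j → A j * - x j)
    -- The degree becomes a row sum, so that `x i` can be spread over the neighbours of `i` and
    -- paired with each `- x j`.
    ≡⟨ cong (λ d → d * x i + rest) (length-filter-tabulate (adj? G i) id) ⟩
  sum A * x i + sum (λ j → A j * - x j)
    ≡⟨ cong (_+ rest) (*-distribʳ-sum (x i) A) ⟩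
  sum (λ j → A j * x i) + sum (λ j → A j * - x j)
    ≡⟨ ∑-distrib-+ (λ j → A j * x i) _ ⟨
  sum (λ j → A j * x i + A j * - x j)
    ≡⟨ sum-cong-≗ (λ j → *-distribˡ-+ (A j) (x i) (- x j)) ⟨
  sum (λ j → A j * (x i - x j)) ∎
  where
  D A : Fin n → ℚ
  D = degreeMatrix G i
  A = adjacencyMatrix G i
  rest = sum (λ j → A j * - x j)
  distrib : ∀ d a y → (d - a) * y ≡ d * y + a * - y
  distrib = solve 3 (λ d a y → (d :- a) :* y := d :* y :+ a :* :- y) refl
    where open +-*-Solver

IsEigenvector : ∀ {n} → Matrix n → ℚ → (Fin n → ℚ) → Set
IsEigenvector A μ x = ∀ i → sum (λ j → A i j * x j) ≡ μ * x i

isEigenvector-scale : ∀ {n} {A : Matrix n} {μ x} c →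
  IsEigenvector A μ x → IsEigenvector A μ (λ i → c * x i)
isEigenvector-scale {A = A} {μ} {x} c Ax≡μx i = begin
  sum (λ j → A i j * (c * x j)) ≡⟨ sum-cong-≗ (λ j → swap (A i j) c (x j)) ⟩
  sum (λ j → c * (A i j * x j)) ≡⟨ *-distribˡ-sum c (λ j → A i j * x j) ⟨
  c * sum (λ j → A i j * x j)   ≡⟨ cong (c *_) (Ax≡μx i) ⟩
  c * (μ * x i)                 ≡⟨ swap c μ (x i) ⟩
  μ * (c * x i)                 ∎
  where
  swap : ∀ a b y → a * (b * y) ≡ b * (a * y)
  swap = solve 3 (λ a b y → a :* (b :* y) := b :* (a :* y)) refl
    where open +-*-Solver

isEigenvector-zero : ∀ {n} (A : Matrix n) μ → IsEigenvector A μ (λ _ → 0ℚ)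
isEigenvector-zero A μ i = trans (sum-zero λ j → *-zeroʳ (A i j)) (sym (*-zeroʳ μ))

glue-isEigenvector : ∀ {n₁ n₂} (G₁ : Graph (Fin n₁)) (G₂ : Graph (Fin n₂)) {u v μ x y} →
  x u ≡ y v →
  IsEigenvector (laplacian G₁) μ x → IsEigenvector (laplacian G₂) μ y →
  IsEigenvector (laplacian (oneEdgeConnection G₁ G₂ u v)) μ ([ x , y ] ∘ splitAt n₁)
glue-isEigenvector {n₁} {n₂} G₁ G₂ {u} {v} {μ} {x} {y} xu≡yv L₁x≡μx L₂y≡μy k = begin
  sum (λ j → laplacian G k j * z (splitAt n₁ j)) ≡⟨ laplacian-apply G (z ∘ splitAt n₁) k ⟩
  sum (term (splitAt n₁ k) ∘ splitAt n₁)         ≡⟨ sum-splitAt n₁ (term (splitAt n₁ k)) ⟩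
  sum (term (splitAt n₁ k) ∘ inj₁) + sum (term (splitAt n₁ k) ∘ inj₂)
                                                 ≡⟨ local (splitAt n₁ k) ⟩
  μ * z (splitAt n₁ k)                           ∎
  where
  G = oneEdgeConnection G₁ G₂ u v

  z : Fin n₁ ⊎ Fin n₂ → ℚ
  z = [ x , y ]

  -- A summand of `laplacian-apply` for `G`, read on the disjoint union, where adjacency computes by
  -- cases on the sides of `s` and `t`.
  term : (s t : Fin n₁ ⊎ Fin n₂) → ℚ
  term s t = (if does (adj? (joinAt G₁ G₂ u v _≟_ _≟_) s t) then 1ℚ else 0ℚ) * (z s - z t)

  x-y≡0 : x u - y v ≡ 0ℚ
  x-y≡0 = trans (cong (_- y v) xu≡yv) (+-inverseʳ (y v))

  y-x≡0 : y v - x u ≡ 0ℚ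
  y-x≡0 = trans (cong (_-_ (y v)) xu≡yv) (+-inverseʳ (y v))

  cross₁₂ : ∀ i j → term (inj₁ i) (inj₂ j) ≡ 0ℚ
  cross₁₂ i j with i ≟ u | j ≟ v
  -- The connecting edge is the only pair across the blocks with coefficient 1, and there the
  -- difference vanishes.
  ... | yes refl | yes refl = trans (*-identityˡ (x u - y v)) x-y≡0
  ... | yes _    | no _     = *-zeroˡ (x i - y j)
  ... | no _     | _        = *-zeroˡ (x i - y j)

  cross₂₁ : ∀ j i → term (inj₂ j) (inj₁ i) ≡ 0ℚ
  cross₂₁ j i with i ≟ u | j ≟ v
  ... | yes refl | yes refl = trans (*-identityˡ (y v - x u)) y-x≡0
  ... | yes _    | no _     = *-zeroˡ (y j - x i)
  ... | no _     | _        = *-zeroˡ (y j - x i)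

  -- The block across from `s` sums to zero. The block on its own side is definitionally the right
  -- side of `laplacian-apply` for `G₁` or `G₂`.
  local : ∀ s → sum (term s ∘ inj₁) + sum (term s ∘ inj₂) ≡ μ * z s
  local (inj₁ i) = begin
    sum (term (inj₁ i) ∘ inj₁) + sum (term (inj₁ i) ∘ inj₂)
      ≡⟨ cong (_+_ (sum (term (inj₁ i) ∘ inj₁))) (sum-zero (cross₁₂ i)) ⟩
    sum (term (inj₁ i) ∘ inj₁) + 0ℚ    ≡⟨ +-identityʳ _ ⟩
    sum (term (inj₁ i) ∘ inj₁)         ≡⟨ laplacian-apply G₁ x i ⟨
    sum (λ j → laplacian G₁ i j * x j) ≡⟨ L₁x≡μx i ⟩
    μ * x i                            ∎
  local (inj₂ i) = begin
    sum (term (inj₂ i) ∘ inj₁) + sum (term (inj₂ i) ∘ inj₂)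
      ≡⟨ cong (_+ sum (term (inj₂ i) ∘ inj₂)) (sum-zero (cross₂₁ i)) ⟩
    0ℚ + sum (term (inj₂ i) ∘ inj₂)    ≡⟨ +-identityˡ _ ⟩
    sum (term (inj₂ i) ∘ inj₂)         ≡⟨ laplacian-apply G₂ y i ⟨
    sum (λ j → laplacian G₂ i j * y j) ≡⟨ L₂y≡μy i ⟩
    μ * y i                            ∎

*-cancelˡ-zero : ∀ {p q} → p ≢ 0ℚ → p * q ≡ 0ℚ → q ≡ 0ℚ
*-cancelˡ-zero {p} {q} p≢0 pq≡0 = begin
  q                ≡⟨ *-identityˡ q ⟨
  1ℚ * q           ≡⟨ cong (_* q) (ℚ.*-inverseˡ p) ⟨
  (1/ p) * p * q   ≡⟨ *-assoc (1/ p) p q ⟩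
  (1/ p) * (p * q) ≡⟨ cong ((1/ p) *_) pq≡0 ⟩
  (1/ p) * 0ℚ      ≡⟨ *-zeroʳ (1/ p) ⟩
  0ℚ               ∎
  where instance _ = ≢-nonZero p≢0

oneEdgeConnection-hasEigenvalue : ∀ {n₁ n₂} (G₁ : Graph (Fin n₁)) (G₂ : Graph (Fin n₂)) μ →
  HasEigenvalue (laplacian G₁) μ → HasEigenvalue (laplacian G₂) μ →
  ∀ u v → HasEigenvalue (laplacian (oneEdgeConnection G₁ G₂ u v)) μ
oneEdgeConnection-hasEigenvalue {n₁} {n₂} G₁ G₂ μ (x , x≢0 , L₁x≡μx) (y , y≢0 , L₂y≡μy) u v
  with x u ℚ.≟ 0ℚ
... | yes xu≡0 =
  [ x , (λ _ → 0ℚ) ] ∘ splitAt n₁ ,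
  -- The first block of the glued vector is `x` itself, which is nonzero.
  (λ z≡0 → x≢0 λ i → trans (cong [ x , _ ] (sym (splitAt-↑ˡ n₁ i n₂))) (z≡0 (i ↑ˡ n₂))) ,
  glue-isEigenvector G₁ G₂ {μ = μ} {x} {λ _ → 0ℚ} xu≡0 L₁x≡μx (isEigenvector-zero (laplacian G₂) μ)
... | no xu≢0 =
  [ x′ , y′ ] ∘ splitAt n₁ ,
  -- Non-vanishing is read off the second block: `y v` may be zero and kill the first, whereas `x u`
  -- is nonzero and can be cancelled.
  (λ z≡0 → y≢0 λ j → *-cancelˡ-zero xu≢0
    (trans (cong [ x′ , y′ ] (sym (splitAt-↑ʳ n₁ n₂ j))) (z≡0 (n₁ ↑ʳ j)))) ,
  -- The cross scaling makes the two values at the ends of the edge the same product, up to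
  -- commutativity.
  glue-isEigenvector G₁ G₂ {μ = μ} {x′} {y′} (*-comm (y v) (x u))
    (isEigenvector-scale {A = laplacian G₁} {μ} (y v) L₁x≡μx)
    (isEigenvector-scale {A = laplacian G₂} {μ} (x u) L₂y≡μy)
  where
  x′ : Fin n₁ → ℚ
  x′ i = y v * x i
  y′ : Fin n₂ → ℚ
  y′ j = x u * y j

theorem15 : ∀ {n₁ n₂} (G₁ : Graph (Fin n₁)) (G₂ : Graph (Fin n₂)) →
    BrokenSun G₁ → ¬ HasPerfectMatching G₁ →
    Unicyclic G₂ → HasPerfectMatching G₂ →
    HasEigenvalue (laplacian G₁) (+ 2 / 1) →
    HasEigenvalue (laplacian G₂) (+ 2 / 1) →
    ∀ (u : Fin n₁) (v : Fin n₂) →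
    HasEigenvalue (laplacian (oneEdgeConnection G₁ G₂ u v)) (+ 2 / 1)
theorem15 G₁ G₂ _ _ _ _ = oneEdgeConnection-hasEigenvalue G₁ G₂ (+ 2 / 1)
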